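{- For every compact ordered space $X$, the convex Vietoris hyperspace $\mathbb{V}^{\mathrm{c}}X$ (with its topology and the Egli–Milner order) is a compact ordered space.
   Context: A compact ordered space is a compact Hausdorff space equipped with a partial order that is a closed subset of $X\times X$ (product topology). For a subset $Y$ of a poset, $\uparrow Y$ and $\downarrow Y$ are its up-closure and down-closure; $Y$ is convex if $y_1\le x\le y_2$ with $y_1,y_2\in Y$ implies $x\in Y$; $\updownarrow Y=\uparrow Y\cap\downarrow Y$. For a compact ordered space $X$, $\mathbb{V}^{\mathrm{c}}X$ is the set of closed convex subsets of $X$ (including $\varnothing$), with the topology generated by the sets $\Diamond U=\{K\mid K\cap U\neq\varnothing\}$ and $\Box U=\{K\mid K\subseteq U\}$ for $U$ ranging over open upsets and open downsets of $X$, and ordered by the Egli–Milner order: $K\le_{\mathrm{EM}}L$ iff $\uparrow L\subseteq\uparrow K$ and $\downarrow K\subseteq\downarrow L$. -}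

module Defs where

open import Data.List.Base using (List)
open import Data.List.Relation.Unary.Any using (Any)
open import Data.Product.Base using (Σ; ∃-syntax; _×_; _,_; uncurry)
open import Data.Product.Relation.Binary.Pointwise.NonDependent using (×-setoid)
open import Data.Sum.Base using (_⊎_)
open import Data.Unit.Polymorphic.Base using (⊤)
open import Function.Base using (_on_; flip)
open import Function.Bundles using (Func)
open import Level using (Level; suc; _⊔_; Setω)
open import Relation.Binary.Bundles using (Setoid)
open import Relation.Binary.Core using (Rel; REL)
open import Relation.Binary.Definitions using (_Respects_; _Respectsˡ_; _Respectsʳ_)
open import Relation.Binary.Structures using (IsPartialOrder)
open import Relation.Nullary.Negation using (¬_)
open import Relation.Unary using (Pred; _∈_; _⊆_; _≐_; _∩_; ∁; ⋃; _≬_; _⊥_; _⟨×⟩_)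
open import Relation.Unary.Relation.Binary.Equality using (≐-isEquivalence)
import Relation.Binary.Construct.On as On

-- Sets are setoids and subsets are predicates that respect the setoid equality.
-- So the set-theoretic axiom of choice (a total relation contains the graph of
-- a function) asks for a function that preserves the equalities.
-- For plain types, where no equality has to be preserved, it would be trivial.
AxiomOfChoice : Setω
AxiomOfChoice =
  ∀ {a ℓa b ℓb r} (A : Setoid a ℓa) (B : Setoid b ℓb)
  (R : REL (Setoid.Carrier A) (Setoid.Carrier B) r) →
  R Respectsˡ Setoid._≈_ A → R Respectsʳ Setoid._≈_ B →
  (∀ x → ∃[ y ] R x y) →
  Σ (Func A B) λ f → ∀ x → R x (Func.to f x)

-- The index types in `Open-⋃` (and in `Compact` below) live in the universe of
-- `Pred Carrier ℓ`, so every set of subsets can be indexed; `W` is there because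
-- the union itself may live in a universe above ℓ.
record TopologicalSpace (c ℓ o : Level) : Set (suc (suc ℓ ⊔ c ⊔ o)) where
  field
    setoid : Setoid c ℓ
  open Setoid setoid public using (Carrier; _≈_; isEquivalence)
  field
    Open      : Pred (Pred Carrier ℓ) o
    Open-resp : ∀ {U} → Open U → U Respects _≈_
    Open-⊤    : Open (λ _ → ⊤)
    Open-∩    : ∀ {U V} → Open U → Open V → Open (U ∩ V)
    Open-⋃    : ∀ {I : Set (c ⊔ suc ℓ)} (U : I → Pred Carrier ℓ) →
                (∀ i → Open (U i)) → ∀ {W} → W ≐ ⋃ I U → Open W

  Closed : Pred (Pred Carrier ℓ) o
  Closed K = Open (∁ K)

  Hausdorff : Set (c ⊔ suc ℓ ⊔ o)
  Hausdorff = ∀ {x y} → ¬ x ≈ y →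
    ∃[ U ] ∃[ V ] Open U × Open V × x ∈ U × y ∈ V × U ⊥ V

  Compact : Set (suc (c ⊔ suc ℓ) ⊔ o)
  Compact = ∀ {I : Set (c ⊔ suc ℓ)} (U : I → Pred Carrier ℓ) →
    (∀ i → Open (U i)) → (∀ x → x ∈ ⋃ I U) →
    Σ (List I) λ is → ∀ x → Any (λ i → x ∈ U i) is

module _ {c ℓ s} (A : Setoid c ℓ) (S : Pred (Pred (Setoid.Carrier A) ℓ) s) where
  open Setoid A using (Carrier; _≈_)

  data Generated : Pred (Pred Carrier ℓ) (suc (c ⊔ suc ℓ) ⊔ s) where
    basic : ∀ {U} → S U → Generated U
    whole : Generated (λ _ → ⊤)
    inter : ∀ {U V} → Generated U → Generated V → Generated (U ∩ V)
    union : ∀ {I : Set (c ⊔ suc ℓ)} (U : I → Pred Carrier ℓ) →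
            (∀ i → Generated (U i)) → ∀ {W} → W ≐ ⋃ I U → Generated W

  module _ (S-resp : ∀ {U} → S U → U Respects _≈_) where

    Generated-resp : ∀ {U} → Generated U → U Respects _≈_
    Generated-resp (basic u)   x≈y x∈U = S-resp u x≈y x∈U
    Generated-resp whole       x≈y _   = _
    Generated-resp (inter u v) x≈y (x∈U , x∈V) =
      Generated-resp u x≈y x∈U , Generated-resp v x≈y x∈V
    Generated-resp (union U u (W⊆ , ⊆W)) x≈y x∈W with W⊆ x∈W
    ... | i , x∈Ui = ⊆W (i , Generated-resp (u i) x≈y x∈Ui)

    generate : TopologicalSpace c ℓ (suc (c ⊔ suc ℓ) ⊔ s)
    generate = record
      { setoid    = A
      ; Open      = Generated
      ; Open-resp = Generated-resp
      ; Open-⊤    = whole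
      ; Open-∩    = inter
      ; Open-⋃    = union
      }

module _ {c ℓ o c′ o′} (X : TopologicalSpace c ℓ o) (Y : TopologicalSpace c′ ℓ o′) where
  private
    module X = TopologicalSpace X
    module Y = TopologicalSpace Y

  data Box : Pred (Pred (X.Carrier × Y.Carrier) ℓ) (c ⊔ c′ ⊔ suc ℓ ⊔ o ⊔ o′) where
    box : ∀ {U V} → X.Open U → Y.Open V → Box (U ⟨×⟩ V)

  productSpace : TopologicalSpace (c ⊔ c′) ℓ (suc (c ⊔ c′ ⊔ suc ℓ) ⊔ (o ⊔ o′))
  productSpace = generate (×-setoid X.setoid Y.setoid) Box
    λ { (box u v) (x≈ , y≈) (x∈U , y∈V) →
          X.Open-resp u x≈ x∈U , Y.Open-resp v y≈ y∈V }

record IsCompactOrderedSpace {c ℓ o} (X : TopologicalSpace c ℓ o)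
       (_≤_ : Rel (TopologicalSpace.Carrier X) ℓ) : Set (suc (c ⊔ suc ℓ) ⊔ o) where
  open TopologicalSpace X
  field
    compact        : Compact
    hausdorff      : Hausdorff
    isPartialOrder : IsPartialOrder _≈_ _≤_
    ≤-closed       : TopologicalSpace.Closed (productSpace X X) (uncurry _≤_)

record CompactOrderedSpace (c ℓ o : Level) : Set (suc (c ⊔ suc ℓ ⊔ o)) where
  field
    space : TopologicalSpace c ℓ o
  open TopologicalSpace space public
  field
    _≤_                   : Rel Carrier ℓ
    isCompactOrderedSpace : IsCompactOrderedSpace space _≤_

module _ {c ℓ o} (X : CompactOrderedSpace c ℓ o) where
  open CompactOrderedSpace X

  ↑ ↓ : Pred Carrier ℓ → Pred Carrier (c ⊔ ℓ)
  ↑ Y x = ∃[ y ] y ∈ Y × y ≤ x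
  ↓ Y x = ∃[ y ] y ∈ Y × x ≤ y

  Upset Downset : Pred (Pred Carrier ℓ) (c ⊔ ℓ)
  Upset   U = U Respects _≤_
  Downset U = U Respects (flip _≤_)

  Convex : Pred (Pred Carrier ℓ) (c ⊔ ℓ)
  Convex Y = ∀ {y₁ x y₂} → y₁ ∈ Y → y₂ ∈ Y → y₁ ≤ x → x ≤ y₂ → x ∈ Y

  record ClosedConvex : Set (c ⊔ suc ℓ ⊔ o) where
    field
      set    : Pred Carrier ℓ
      closed : Closed set
      convex : Convex set
  open ClosedConvex

  𝕍ᶜ-setoid : Setoid (c ⊔ suc ℓ ⊔ o) (c ⊔ ℓ)
  𝕍ᶜ-setoid = record
    { Carrier       = ClosedConvex
    ; _≈_           = _≐_ on set
    ; isEquivalence = On.isEquivalence set ≐-isEquivalence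
    }

  ◇ □ : Pred Carrier ℓ → Pred ClosedConvex (c ⊔ ℓ)
  ◇ U K = set K ≬ U
  □ U K = set K ⊆ U

  data 𝕍ᶜ-Subbasis : Pred (Pred ClosedConvex (c ⊔ ℓ)) (c ⊔ suc ℓ ⊔ o) where
    ◇-open : ∀ {U} → Open U → Upset U ⊎ Downset U → 𝕍ᶜ-Subbasis (◇ U)
    □-open : ∀ {U} → Open U → Upset U ⊎ Downset U → 𝕍ᶜ-Subbasis (□ U)

  𝕍ᶜ : TopologicalSpace (c ⊔ suc ℓ ⊔ o) (c ⊔ ℓ) (suc (suc c ⊔ suc ℓ ⊔ o))
  𝕍ᶜ = generate 𝕍ᶜ-setoid 𝕍ᶜ-Subbasis λ where
    (◇-open _ _) (K⊆L , _) (x , x∈K , x∈U) → x , K⊆L x∈K , x∈U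
    (□-open _ _) (_ , L⊆K) K⊆U x∈L         → K⊆U (L⊆K x∈L)

  infix 4 _≤EM_
  _≤EM_ : Rel ClosedConvex (c ⊔ ℓ)
  K ≤EM L = ↑ (set L) ⊆ ↑ (set K) × ↓ (set K) ⊆ ↓ (set L)

{-# OPTIONS --safe #-}
-- In a compact ordered space, closed sets A and B with no a ≤ b are separated by
-- disjoint sets, an open upset around A and an open downset around B. Applied to
-- a closed convex set and a principal upset or downset, this gives disjoint
-- subbasic neighbourhoods witnessing K ≰EM L, hence closedness of ≤EM and, with
-- antisymmetry, the Hausdorff property. For compactness, let a subbasic cover be
-- given and let K be the complement of the union of all V with ◇ V in the cover.
-- K is closed and convex and lies in no such ◇ V, so K ∈ □ V for a member □ V of
-- the cover; by compactness of ∁ V finitely many ◇ Vᵢ together with □ V suffice.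
-- Alexander's subbase lemma, via Zorn's lemma for sets of subsets, concludes.
module Submission where

open import Axiom.ExcludedMiddle using (ExcludedMiddle)
open import Data.Empty using (⊥-elim)
open import Data.Empty.Polymorphic using (⊥)
open import Data.List.Base using (List; []; _∷_; _++_; map)
open import Data.List.Relation.Unary.All as All using (All; []; _∷_)
import Data.List.Relation.Unary.All.Properties as All
open import Data.List.Relation.Unary.Any as Any using (Any; here; there)
import Data.List.Relation.Unary.Any.Properties as Any
open import Data.Product.Base using (Σ; ∃-syntax; _×_; _,_; proj₁; proj₂)
open import Data.Sum.Base using (_⊎_; inj₁; inj₂; [_,_]′)
open import Data.Unit.Polymorphic.Base using (⊤)
open import Function.Base using (_∘_; flip; id)
open import Function.Bundles using (Func)
open import Level using (Level; suc; _⊔_; 0ℓ)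
open import Relation.Binary.Bundles using (Setoid)
open import Relation.Binary.Core using (Rel)
open import Relation.Binary.Definitions using (_Respects_)
open import Relation.Binary.PropositionalEquality.Core using (_≡_; refl)
open import Relation.Binary.Structures using (IsPartialOrder)
open import Relation.Nullary.Decidable.Core
  using (yes; no; True; toWitness; fromWitness; decidable-stable)
open import Relation.Nullary.Negation using (¬_; contradiction)
open import Relation.Unary using (Pred; _∈_; _∉_; _⊆_; _≐_; _∩_; _∪_; ∁; ⋃)
  renaming (_⊥_ to _Disjoint_)
open import Relation.Unary.Relation.Binary.Equality using (≐-setoid)
open import Defs

private
  variable
    a b c ℓ o p q s : Level

-- Finite lists of subsets and finite subcovers.

module _ {A : Set a} where

  Covers FiniteSubcover : Pred (Pred A ℓ) q → Set (a ⊔ suc ℓ ⊔ q)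
  Covers 𝒰         = ∀ x → ∃[ U ] U ∈ 𝒰 × x ∈ U
  FiniteSubcover 𝒰 = ∃[ Us ] All 𝒰 Us × ∀ x → Any (x ∈_) Us

  remove : ∀ {G : Pred A ℓ} {𝒰 : Pred (Pred A ℓ) q} {Us} → All ((_≡ G) ∪ 𝒰) Us →
           ∃[ Vs ] All 𝒰 Vs × ∀ {x} → Any (x ∈_) Us → x ∈ G ⊎ Any (x ∈_) Vs
  remove [] = [] , [] , λ ()
  remove (inj₁ refl ∷ us) with remove us
  ... | Vs , vs , f = Vs , vs , λ { (here x∈G) → inj₁ x∈G ; (there x∈) → f x∈ }
  remove (inj₂ u ∷ us) with remove us
  ... | Vs , vs , f = _ ∷ Vs , u ∷ vs , λ where
    (here x∈U) → inj₂ (here x∈U)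
    (there x∈) → [ inj₁ , inj₂ ∘ there ]′ (f x∈)

  indices : ∀ {I : Set b} {U : I → Pred A ℓ} {Vs} → All (λ V → ∃[ i ] V ≡ U i) Vs →
            Σ (List I) λ is → ∀ {x} → Any (x ∈_) Vs → Any (λ i → x ∈ U i) is
  indices [] = [] , λ ()
  indices ((i , refl) ∷ vs) with indices vs
  ... | is , f = i ∷ is , λ { (here x∈U) → here x∈U ; (there x∈) → there (f x∈) }

  -- A finite list uses only finitely many members of the chain, and the largest of these serves all
  -- entries. The alternative `All P xs` also covers an empty index type.
  all-in-chain : ∀ {I : Set b} {P : Pred A p} {W : Pred A q} {C : I → Pred A q} →
    (∀ i j → C i ⊆ C j ⊎ C j ⊆ C i) → W ⊆ ⋃ I C → ∀ {xs} →
    All (P ∪ W) xs → All P xs ⊎ ∃[ i ] All (P ∪ C i) xs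
  all-in-chain chain W⊆ [] = inj₁ []
  all-in-chain {P = P} {C = C} chain W⊆ (x ∷ xs) with x | all-in-chain chain W⊆ xs
  ... | inj₁ Px | inj₁ Pxs       = inj₁ (Px ∷ Pxs)
  ... | inj₁ Px | inj₂ (i , xs′) = inj₂ (i , inj₁ Px ∷ xs′)
  ... | inj₂ Wx | inj₁ Pxs       = let i , Cx = W⊆ Wx in inj₂ (i , inj₂ Cx ∷ All.map inj₁ Pxs)
  ... | inj₂ Wx | inj₂ (i , xs′) with W⊆ Wx
  ...   | j , Cx with chain i j
  ...     | inj₁ i⊆j = inj₂ (j , inj₂ Cx ∷ All.map [ inj₁ , (λ x∈ → inj₂ (i⊆j x∈)) ]′ xs′)
  ...     | inj₂ j⊆i = inj₂ (i , inj₂ (j⊆i Cx) ∷ xs′)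

-- Towers of subsets and Zorn's lemma.

-- The transfinite iterates of `next`, starting from the empty union.
module _ {A : Set a} (next : Pred A ℓ → Pred A ℓ) where

  data Tower : Pred A ℓ → Set (suc (a ⊔ suc ℓ)) where
    step : ∀ {C} → Tower C → Tower (next C)
    sup  : ∀ {I : Set (a ⊔ suc ℓ)} (C : I → Pred A ℓ) →
           (∀ i → Tower (C i)) → ∀ {W} → W ≐ ⋃ I C → Tower W

module _ (em : ∀ {ℓ} → ExcludedMiddle ℓ) where

  dne : {P : Set p} → ¬ ¬ P → P
  dne = decidable-stable em

  -- Excluded middle moves every proposition to every universe level.
  record Resized {p q} (P : Set p) : Set q where
    constructor lift
    field lower : True (em {P = P})

  resize : {P : Set p} → P → Resized {q = q} P
  resize p = lift (fromWitness p)

  unresize : {P : Set p} → Resized {q = q} P → P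
  unresize = toWitness ∘ Resized.lower

  module _ {A : Set a} (next : Pred A ℓ → Pred A ℓ)
           (inflationary : ∀ C → C ⊆ next C)
           (next-mono-≐ : ∀ {B C} → B ≐ C → next B ⊆ next C) where

    -- The Bourbaki–Witt notion: B ⊂ C implies next B ⊆ C, read classically.
    Extreme : Pred A ℓ → Set (suc (a ⊔ suc ℓ))
    Extreme C = ∀ {B} → Tower next B → B ⊆ C → C ⊆ B ⊎ next B ⊆ C

    -- Induction on `B`: extremeness stops a step from jumping over `C`, and a union either has a
    -- member above `next C` or has all its members below `C`.
    extreme-compare : ∀ {B C} → Extreme C → Tower next B → B ⊆ C ⊎ next C ⊆ B
    extreme-compare {C = C} ext (step {B} t) with extreme-compare ext t
    ... | inj₂ sC⊆B = inj₂ λ x → inflationary B (sC⊆B x)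
    ... | inj₁ B⊆C with ext t B⊆C
    ...   | inj₁ C⊆B  = inj₂ (next-mono-≐ (C⊆B , B⊆C))
    ...   | inj₂ sB⊆C = inj₁ sB⊆C
    extreme-compare {C = C} ext (sup B t (W⊆ , ⊆W)) with em {P = ∃[ i ] next C ⊆ B i}
    ... | yes (i , sC⊆B) = inj₂ λ x → ⊆W (i , sC⊆B x)
    ... | no ∄i = inj₁ λ x∈W → let i , x∈B = W⊆ x∈W in
      [ (λ B⊆C → B⊆C x∈B) , (λ sC⊆B → contradiction (i , λ {x} → sC⊆B {x}) ∄i) ]′
        (extreme-compare ext (t i))

    -- Induction on `C`. A union lies in `B` if `B` contains every `next (C i)`; otherwise `B` lies
    -- inside some `C i`, where the induction hypothesis applies.
    tower-extreme : ∀ {C} → Tower next C → Extreme C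
    tower-extreme (step {C} t) u B⊆sC with extreme-compare (tower-extreme t) u
    ... | inj₂ sC⊆B = inj₁ sC⊆B
    ... | inj₁ B⊆C with tower-extreme t u B⊆C
    ...   | inj₁ C⊆B  = inj₂ (next-mono-≐ (B⊆C , C⊆B))
    ...   | inj₂ sB⊆C = inj₂ λ x → inflationary C (sB⊆C x)
    tower-extreme (sup C t {W} (W⊆ , ⊆W)) {B} u B⊆W with em {P = ∃[ i ] ¬ next (C i) ⊆ B}
    ... | no ∄i = inj₁ λ x∈W → let i , x∈C = W⊆ x∈W in
      dne {P = next (C i) ⊆ B} (λ ⊈ → ∄i (i , ⊈)) (inflationary (C i) x∈C)
    ... | yes (i , sC⊈B) with extreme-compare (tower-extreme (t i)) u
    ...   | inj₂ sC⊆B = contradiction (λ {x} → sC⊆B {x}) sC⊈B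
    ...   | inj₁ B⊆C with tower-extreme (t i) u B⊆C
    ...     | inj₂ sB⊆C = inj₂ λ x → ⊆W (i , sB⊆C x)
    -- Now `B` and `C i` coincide. Either `W` stops at `C i`, or it contains `next (C i)` and with
    -- it `next B`.
    ...     | inj₁ C⊆B with extreme-compare (tower-extreme (t i)) (sup C t {W} (W⊆ , ⊆W))
    ...       | inj₁ W⊆C  = inj₁ λ x → C⊆B (W⊆C x)
    ...       | inj₂ sC⊆W = inj₂ λ x → sC⊆W (next-mono-≐ (B⊆C , C⊆B) x)

    tower-chain : ∀ {B C} → Tower next B → Tower next C → B ⊆ C ⊎ C ⊆ B
    tower-chain {C = C} t u with extreme-compare (tower-extreme u) t
    ... | inj₁ B⊆C  = inj₁ B⊆C
    ... | inj₂ sC⊆B = inj₂ λ x → sC⊆B (inflationary C x)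

  -- The empty chain counts, so `P` holds of the empty set; one-member chains make `P` invariant
  -- under `≐`.
  ChainClosed : {A : Set a} → Pred (Pred A ℓ) p → Set (suc (a ⊔ suc ℓ) ⊔ p)
  ChainClosed {a = a} {ℓ = ℓ} {A = A} P =
    ∀ {I : Set (a ⊔ suc ℓ)} (C : I → Pred A ℓ) → (∀ i → C i ∈ P) →
    (∀ i j → C i ⊆ C j ⊎ C j ⊆ C i) → ∀ {W} → W ≐ ⋃ I C → W ∈ P

  Maximal : {A : Set a} → Pred (Pred A ℓ) p → Pred (Pred A ℓ) (a ⊔ suc ℓ ⊔ p)
  Maximal P M = ∀ {N} → N ∈ P → M ⊆ N → N ⊆ M

  -- The union `M` of all stages of the tower is itself a stage, so `next M` adds nothing to it;
  -- `next` is chosen to stall within `P` only at maximal sets.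
  zorn : AxiomOfChoice → {A : Set a} (P : Pred (Pred A ℓ) p) → ChainClosed P →
         ∃[ M ] M ∈ P × Maximal P M
  zorn {ℓ = ℓ} choice {A} P P-chain =
    M , tower-P M-tower , proj₂ (proj₂ (next-spec M) (tower-P M-tower)) sM⊆M
    where
    Next : Rel (Pred A ℓ) _
    Next C D = C ⊆ D × (C ∈ P → D ∈ P × (D ⊆ C → Maximal P C))

    P-resp : ∀ {C D} → C ≐ D → C ∈ P → D ∈ P
    P-resp {C} (C⊆D , D⊆C) C∈P = P-chain {I = ⊤} (λ _ → C)
      (λ _ → C∈P) (λ _ _ → inj₁ id) ((λ x → _ , D⊆C x) , λ (_ , x) → C⊆D x)

    ∃-next : ∀ C → ∃[ D ] Next C D
    ∃-next C with em {P = ∃[ N ] N ∈ P × C ⊆ N × ¬ N ⊆ C}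
    ... | yes (N , N∈P , C⊆N , N⊈C) =
      N , C⊆N , λ _ → N∈P , λ N⊆C → contradiction (λ {x} → N⊆C {x}) N⊈C
    ... | no ∄N = C , id , λ C∈P → C∈P , λ _ {N} N∈P C⊆N →
      dne {P = N ⊆ C} λ N⊈C → ∄N (N , N∈P , C⊆N , N⊈C)

    -- Choice on the setoid of subsets yields a `next` that respects `≐`, as the comparison of
    -- stages requires. The price is that `Next` must respect `≐` on both sides.
    chosen = choice (≐-setoid A ℓ) (≐-setoid A ℓ) Next
      (λ { {D} {B} {C} B≐C@(B⊆C , C⊆B) (B⊆D , f) →
           (λ x → B⊆D (C⊆B x)) , λ C∈P → let D∈P , g = f (P-resp (C⊆B , B⊆C) C∈P) in
           D∈P , λ D⊆C {N} N∈P C⊆N {x} x∈N →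
             B⊆C (g (λ y → C⊆B (D⊆C y)) N∈P (λ y → C⊆N (B⊆C y)) x∈N) })
      (λ { D≐E@(D⊆E , E⊆D) (C⊆D , f) →
           (λ x → D⊆E (C⊆D x)) , λ C∈P → let D∈P , g = f C∈P in
           P-resp D≐E D∈P , λ E⊆C → g (λ y → E⊆C (D⊆E y)) })
      ∃-next

    next : Pred A ℓ → Pred A ℓ
    next = Func.to (proj₁ chosen)

    next-spec : ∀ C → Next C (next C)
    next-spec = proj₂ chosen

    chain : ∀ {B C} → Tower next B → Tower next C → B ⊆ C ⊎ C ⊆ B
    chain = tower-chain next (λ C → proj₁ (next-spec C))
      (λ B≐C → proj₁ (Func.cong (proj₁ chosen) B≐C))

    tower-P : ∀ {C} → Tower next C → C ∈ P
    tower-P (step {C} t)    = proj₁ (proj₂ (next-spec C) (tower-P t))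
    tower-P (sup C t W≐⋃) =
      P-chain C (λ i → tower-P (t i)) (λ i j → chain (t i) (t j)) W≐⋃

    -- `Resized` brings the union over all stages back to level `ℓ`, so that `M` can be a stage.
    M : Pred A ℓ
    M x = Resized (∃[ C ] Tower next C × x ∈ C)

    M-tower : Tower next M
    M-tower = sup {I = Σ (Pred A ℓ) λ C → Resized {q = 0ℓ} (Tower next C)} proj₁
      (λ i → unresize (proj₂ i))
      ( (λ x∈M → let C , t , x∈C = unresize x∈M in (C , resize t) , x∈C)
      , λ ((C , t) , x∈C) → resize (C , unresize t , x∈C) )

    sM⊆M : next M ⊆ M
    sM⊆M x = resize (next M , step M-tower , x)

  -- Alexander's subbase lemma.

  module _ (choice : AxiomOfChoice) (A : Setoid c ℓ)
           (S : Pred (Pred (Setoid.Carrier A) ℓ) s)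
           (S-resp : ∀ {U} → S U → U Respects (Setoid._≈_ A)) where
    open Setoid A using (Carrier)

    -- Without a finite subcover, enlarge the cover by a maximal `M` that still admits none. Some
    -- point `x` avoids all subbasic members of `M`, so every open set around `x` is large. This
    -- holds for the `U i` containing `x`, and the finite list witnessing it completes `U i` to a
    -- forbidden subcover.
    alexander : ({𝒰 : Pred (Pred Carrier ℓ) 0ℓ} → 𝒰 ⊆ S → Covers 𝒰 → FiniteSubcover 𝒰) →
                TopologicalSpace.Compact (generate A S S-resp)
    alexander S-compact {I} U U-open U-covers = dne λ no-subcover →
      let
        𝒞-none : ¬ FiniteSubcover 𝒞
        𝒞-none = λ (Vs , vs , cov) → let is , f = indices vs in
          no-subcover (is , λ x → f (cov x))

        M , M-none , M-max = zorn choice NoSubcover (noSubcover-chain 𝒞-none)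
        x , x∉ = limit M M-none
        i , x∈U = U-covers x
        Vs , vs , cov = converge M M-max x x∉ (U-open i) x∈U
      in M-none (U i ∷ Vs , inj₁ (i , refl) ∷ vs , λ y → [ here , there ]′ (cov y))
      where
      𝒞 : Pred (Pred Carrier ℓ) _
      𝒞 V = ∃[ i ] V ≡ U i

      -- The cover `𝒞` is adjoined instead of being required inside `𝒟`, so that the empty family
      -- qualifies, as `ChainClosed` demands.
      NoSubcover : Pred (Pred (Pred Carrier ℓ) 0ℓ) _
      NoSubcover 𝒟 = ¬ FiniteSubcover (𝒞 ∪ 𝒟)

      noSubcover-chain : ¬ FiniteSubcover 𝒞 → ChainClosed NoSubcover
      noSubcover-chain 𝒞-none C C-none chain (W⊆ , _) (Us , us , cov)
        with all-in-chain chain W⊆ us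
      ... | inj₁ us′       = 𝒞-none (Us , us′ , cov)
      ... | inj₂ (i , us′) = C-none i (Us , us′ , cov)

      module _ (M : Pred (Pred Carrier ℓ) 0ℓ) where

        -- Maximality makes the complements of the members of M an ultrafilter;
        -- these are its elements.
        Large : Pred (Pred Carrier ℓ) _
        Large G = ∃[ Us ] All (𝒞 ∪ M) Us × ∀ x → x ∈ G ⊎ Any (x ∈_) Us

        -- By maximality, adding `G` to `M` creates a finite subcover; deleting `G` from it leaves
        -- the list that witnesses largeness.
        ∉⇒large : Maximal NoSubcover M → ∀ {G} → G ∉ M → Large G
        ∉⇒large M-max {G} G∉M
          with em {P = FiniteSubcover (𝒞 ∪ (M ∪ λ V → Resized (V ≡ G)))}
        ... | no none = contradiction (M-max none inj₁ (inj₂ (resize refl))) G∉M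
        ... | yes (Us , us , cov) =
          let Vs , vs , f = remove {𝒰 = 𝒞 ∪ M} (All.map reorder us)
          in Vs , vs , λ x → f (cov x)
          where
          reorder : 𝒞 ∪ (M ∪ λ V → Resized (V ≡ G)) ⊆ (_≡ G) ∪ (𝒞 ∪ M)
          reorder (inj₁ v)        = inj₂ (inj₁ v)
          reorder (inj₂ (inj₁ v)) = inj₂ (inj₂ v)
          reorder (inj₂ (inj₂ e)) = inj₁ (unresize e)

        limit : NoSubcover M → ∃[ x ] ∀ {V} → S V → x ∈ V → V ∉ M
        limit M-none = dne λ none →
          let Us , us , cov = S-compact {𝒰 = λ V → Resized (S V × V ∈ M)}
                (λ v → proj₁ (unresize v))
                (λ x → dne λ ∄V → none (x , λ {V} sV x∈V V∈M →
                  ∄V (V , resize (sV , V∈M) , x∈V)))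
          in M-none (Us , All.map (λ v → inj₂ (proj₂ (unresize v))) us , cov)

        -- Large sets include the whole space and are closed under finite intersections and
        -- supersets, so largeness passes from subbasic to all generated neighbourhoods of `x`.
        converge : Maximal NoSubcover M → ∀ x → (∀ {V} → S V → x ∈ V → V ∉ M) →
                   ∀ {G} → Generated A S G → x ∈ G → Large G
        converge M-max x x∉ (basic sV) x∈V = ∉⇒large M-max (x∉ sV x∈V)
        converge M-max x x∉ whole _ = [] , [] , λ _ → inj₁ _
        converge M-max x x∉ (inter {G} {H} g h) (x∈G , x∈H)
          with converge M-max x x∉ g x∈G | converge M-max x x∉ h x∈H
        ... | Us , us , f | Vs , vs , k = Us ++ Vs , All.++⁺ us vs , λ y → join (f y) (k y)
          where
          join : ∀ {y} → y ∈ G ⊎ Any (y ∈_) Us → y ∈ H ⊎ Any (y ∈_) Vs →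
                 y ∈ (G ∩ H) ⊎ Any (y ∈_) (Us ++ Vs)
          join (inj₁ y∈G) (inj₁ y∈H) = inj₁ (y∈G , y∈H)
          join (inj₂ y∈)  _          = inj₂ (Any.++⁺ˡ y∈)
          join (inj₁ _)   (inj₂ y∈)  = inj₂ (Any.++⁺ʳ Us y∈)
        converge M-max x x∉ (union V v (W⊆ , ⊆W)) x∈W with W⊆ x∈W
        ... | i , x∈Vi with converge M-max x x∉ (v i) x∈Vi
        ...   | Us , us , f =
          Us , us , λ y → [ (λ y∈V → inj₁ (⊆W (i , y∈V))) , inj₂ ]′ (f y)

  -- Compactness and relations closed in the product.

  module _ (X : TopologicalSpace c ℓ o) where
    open TopologicalSpace X

    -- `W` is the union of all open sets inside it; `Resized` fits their openness proofs into the
    -- index universe of `Open-⋃`.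
    locally-open : ∀ {W} → (∀ {x} → x ∈ W → ∃[ U ] Open U × x ∈ U × U ⊆ W) → Open W
    locally-open {W} nbhd =
      Open-⋃ {I = Σ (Pred Carrier ℓ) λ U → Resized {q = 0ℓ} (Open U × U ⊆ W)} proj₁
        (λ i → proj₁ (unresize (proj₂ i)))
        ( (λ x∈W → let U , u , x∈U , U⊆W = nbhd x∈W in (U , resize (u , U⊆W)) , x∈U)
        , λ ((U , u) , x∈U) → proj₂ (unresize u) x∈U )

    open-∅ : Open (λ _ → ⊥)
    open-∅ = locally-open λ ()

    open-∪ : ∀ {U V} → Open U → Open V → Open (U ∪ V)
    open-∪ {U} {V} u v = locally-open λ where
      (inj₁ x∈U) → U , u , x∈U , inj₁
      (inj₂ x∈V) → V , v , x∈V , inj₂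

    closed-∁ : ∀ {U} → Open U → Closed (∁ U)
    closed-∁ {U} u = locally-open λ ¬x∉U → U , u , dne ¬x∉U , λ x∈U x∉U → x∉U x∈U

    module _ (compact : Compact) where

      -- Together with `∁ A` the family covers the whole space; `∁ A` is then dropped from the
      -- finite subcover.
      compact-closed : ∀ {A} → Closed A → (𝒰 : Pred (Pred Carrier ℓ) q) → 𝒰 ⊆ Open →
        (∀ {x} → x ∈ A → ∃[ U ] U ∈ 𝒰 × x ∈ U) →
        ∃[ Us ] All 𝒰 Us × ∀ {x} → x ∈ A → Any (x ∈_) Us
      compact-closed {A = A} A-closed 𝒰 𝒰-open A-covered =
        let is , cov = compact {I = Σ (Pred Carrier ℓ) λ U → Resized {q = 0ℓ} (𝒱 U)} proj₁
              (λ i → 𝒱-open (unresize (proj₂ i))) covered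
            Us , us , f = remove {𝒰 = 𝒰} (All.map⁺ {f = proj₁}
              (All.universal (λ i → unresize (proj₂ i)) is))
        in Us , us , λ x∈A → [ contradiction x∈A , id ]′ (f (Any.map⁺ (cov _)))
        where
        𝒱 : Pred (Pred Carrier ℓ) _
        𝒱 = (_≡ ∁ A) ∪ 𝒰

        𝒱-open : 𝒱 ⊆ Open
        𝒱-open (inj₁ refl) = A-closed
        𝒱-open (inj₂ u)    = 𝒰-open u

        covered : ∀ x → ∃[ i ] x ∈ proj₁ i
        covered x with em {P = x ∈ A}
        ... | no x∉A = (∁ A , resize (inj₁ refl)) , x∉A
        ... | yes x∈A = let U , u , x∈U = A-covered x∈A in (U , resize (inj₂ u)) , x∈U

      compact-directed : ∀ {A} → Closed A → (𝒰 : Pred (Pred Carrier ℓ) q) → 𝒰 ⊆ Open →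
        (λ _ → ⊥) ∈ 𝒰 → (∀ {U V} → U ∈ 𝒰 → V ∈ 𝒰 → (U ∪ V) ∈ 𝒰) →
        (∀ {x} → x ∈ A → ∃[ U ] U ∈ 𝒰 × x ∈ U) → ∃[ U ] U ∈ 𝒰 × A ⊆ U
      compact-directed A-closed 𝒰 𝒰-open 𝒰-∅ 𝒰-∪ A-covered =
        let Us , us , cov = compact-closed A-closed 𝒰 𝒰-open A-covered
            W , w , f = unite us
        in W , w , λ x∈A → f (cov x∈A)
        where
        unite : ∀ {Us} → All 𝒰 Us → ∃[ W ] W ∈ 𝒰 × ∀ {x} → Any (x ∈_) Us → x ∈ W
        unite [] = _ , 𝒰-∅ , λ ()
        unite (u ∷ us) with unite us
        ... | W , w , f =
          _ , 𝒰-∪ u w , λ { (here x∈U) → inj₁ x∈U ; (there x∈) → inj₂ (f x∈) }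

      module _ (R : Rel Carrier ℓ) where

        Unrelated : Pred Carrier ℓ → Pred Carrier ℓ → Set (c ⊔ ℓ)
        Unrelated A B = ∀ {x y} → x ∈ A → y ∈ B → ¬ R x y

        -- Resized to level `ℓ`, where `Closed` makes sense; `↑ X` and `↓ X` land in level `c ⊔ ℓ`.
        image : Pred Carrier ℓ → Pred Carrier ℓ
        image A y = Resized (∃[ x ] x ∈ A × R x y)

        -- Closedness of `R` in the product, expressed by boxes that miss `R`.
        Separated : Set (c ⊔ suc ℓ ⊔ o)
        Separated = ∀ {x y} → ¬ R x y →
          ∃[ U ] ∃[ V ] Open U × Open V × x ∈ U × y ∈ V × Unrelated U V

        module _ (separated : Separated) where

          -- Pairs of neighbourhoods combine by uniting the `U` and intersecting the `V`, so the
          -- admissible `U` form a directed cover of `A`. `separate` repeats this over the points of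
          -- `B`.
          separate-point : ∀ {A y} → Closed A → (∀ {x} → x ∈ A → ¬ R x y) →
            ∃[ U ] (Open U × ∃[ V ] Open V × y ∈ V × Unrelated U V) × A ⊆ U
          separate-point {y = y} A-closed A≁y = compact-directed A-closed
            (λ U → Open U × ∃[ V ] Open V × y ∈ V × Unrelated U V) proj₁
            (open-∅ , _ , Open-⊤ , _ , λ ())
            (λ (u , V , v , y∈V , ≁) (u′ , V′ , v′ , y∈V′ , ≁′) →
              open-∪ u u′ , V ∩ V′ , Open-∩ v v′ , (y∈V , y∈V′) , λ where
                (inj₁ x∈U)  (z∈V , _)  → ≁ x∈U z∈V
                (inj₂ x∈U′) (_ , z∈V′) → ≁′ x∈U′ z∈V′)
            (λ x∈A → let U , V , u , v , x∈U , y∈V , ≁ = separated (A≁y x∈A) in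
              U , (u , V , v , y∈V , ≁) , x∈U)

          separate : ∀ {A B} → Closed A → Closed B → Unrelated A B →
            ∃[ V ] (Open V × ∃[ U ] Open U × A ⊆ U × Unrelated U V) × B ⊆ V
          separate {A} A-closed B-closed A≁B = compact-directed B-closed
            (λ V → Open V × ∃[ U ] Open U × A ⊆ U × Unrelated U V) proj₁
            (open-∅ , _ , Open-⊤ , _ , λ _ ())
            (λ (v , U , u , A⊆U , ≁) (v′ , U′ , u′ , A⊆U′ , ≁′) →
              open-∪ v v′ , U ∩ U′ , Open-∩ u u′ , (λ x∈A → A⊆U x∈A , A⊆U′ x∈A) , λ where
                (x∈U , _)  (inj₁ y∈V)  → ≁ x∈U y∈V
                (_ , x∈U′) (inj₂ y∈V′) → ≁′ x∈U′ y∈V′)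
            (λ y∈B → let U , (u , V , v , y∈V , ≁) , A⊆U =
                           separate-point A-closed (λ x∈A → A≁B x∈A y∈B)
                     in V , (v , U , u , A⊆U , ≁) , y∈V)

          closed-image : ∀ {A} → Closed A → Closed (image A)
          closed-image {A} A-closed = locally-open {W = ∁ (image A)} λ y∉ →
            let U , (_ , V , v , y∈V , ≁) , A⊆U =
                  separate-point A-closed (λ x∈A xRy → y∉ (resize (_ , x∈A , xRy)))
            in V , v , y∈V , λ z∈V z∈ →
              let x , x∈A , xRz = unresize z∈ in ≁ (A⊆U x∈A) z∈V xRz

  open-box : (X : TopologicalSpace c ℓ o) (let open TopologicalSpace X) →
    ∀ {G x y} → TopologicalSpace.Open (productSpace X X) G → (x , y) ∈ G →
    ∃[ U ] ∃[ V ] Open U × Open V × x ∈ U × y ∈ V ×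
      (∀ {u v} → u ∈ U → v ∈ V → (u , v) ∈ G)
  open-box X (basic (box u v)) (x∈U , y∈V) = _ , _ , u , v , x∈U , y∈V , _,_
  open-box X whole _ = _ , _ , X.Open-⊤ , X.Open-⊤ , _ , _ , _
    where module X = TopologicalSpace X
  open-box X (inter g h) (∈G , ∈H) with open-box X g ∈G | open-box X h ∈H
  ... | U , V , u , v , x∈U , y∈V , f | U′ , V′ , u′ , v′ , x∈U′ , y∈V′ , f′ =
    U ∩ U′ , V ∩ V′ , X.Open-∩ u u′ , X.Open-∩ v v′ , (x∈U , x∈U′) , (y∈V , y∈V′) ,
    λ (∈U , ∈U′) (∈V , ∈V′) → f ∈U ∈V , f′ ∈U′ ∈V′
    where module X = TopologicalSpace X
  open-box X (union _ g (W⊆ , ⊆W)) ∈W with W⊆ ∈W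
  ... | i , ∈G with open-box X (g i) ∈G
  ...   | U , V , u , v , x∈U , y∈V , f =
    U , V , u , v , x∈U , y∈V , λ ∈U ∈V → ⊆W (i , f ∈U ∈V)

  -- Separation by open upsets and downsets.

  module _ (X : CompactOrderedSpace c ℓ o) where
    open CompactOrderedSpace X
    open IsCompactOrderedSpace isCompactOrderedSpace
    open IsPartialOrder isPartialOrder using (antisym)
      renaming (refl to ≤-refl; trans to ≤-trans)
    open ClosedConvex

    private
      _≥_ : Rel Carrier ℓ
      _≥_ = flip _≤_

    ≤-separated : Separated space compact _≤_
    ≤-separated = open-box space ≤-closed

    ≥-separated : Separated space compact _≥_
    ≥-separated ≱ = let U , V , u , v , x∈U , y∈V , ≰ = ≤-separated ≱ in
      V , U , v , u , y∈V , x∈U , λ ∈V ∈U → ≰ ∈U ∈V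

    closed-upper : ∀ x → Closed (x ≤_)
    closed-upper x = locally-open space λ x≰y →
      let U , V , _ , v , x∈U , y∈V , ≰ = ≤-separated x≰y in V , v , y∈V , ≰ x∈U

    closed-lower : ∀ y → Closed (_≤ y)
    closed-lower y = locally-open space λ x≰y →
      let U , V , u , _ , x∈U , y∈V , ≰ = ≤-separated x≰y in
      U , u , x∈U , λ z∈U → ≰ z∈U y∈V

    private
      ↑ᶜ ↓ᶜ : Pred Carrier ℓ → Pred Carrier ℓ
      ↑ᶜ = image space compact _≤_
      ↓ᶜ = image space compact _≥_

    -- The largest upset inside `U` is the complement of the down-closure of `∁ U`, which is closed
    -- as the image of a closed set.
    upset-interior : ∀ {A U} → Open U → ↑ᶜ A ⊆ U →
      ∃[ U′ ] Open U′ × Upset X U′ × A ⊆ U′ × U′ ⊆ U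
    upset-interior {A} {U} u ↑A⊆U =
      ∁ (↓ᶜ (∁ U)) , closed-image space compact _≥_ ≥-separated (closed-∁ space u) ,
      up , A⊆ , λ x∉ → dne λ x∉U → x∉ (resize (_ , x∉U , ≤-refl))
      where
      up : Upset X (∁ (↓ᶜ (∁ U)))
      up x≤y x∉ y∈ with unresize y∈
      ... | z , z∉U , y≤z = x∉ (resize (z , z∉U , ≤-trans x≤y y≤z))

      A⊆ : A ⊆ ∁ (↓ᶜ (∁ U))
      A⊆ x∈A x∈ with unresize x∈
      ... | z , z∉U , x≤z = z∉U (↑A⊆U (resize (_ , x∈A , x≤z)))

    downset-interior : ∀ {B V} → Open V → ↓ᶜ B ⊆ V →
      ∃[ V′ ] Open V′ × Downset X V′ × B ⊆ V′ × V′ ⊆ V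
    downset-interior {B} {V} v ↓B⊆V =
      ∁ (↑ᶜ (∁ V)) , closed-image space compact _≤_ ≤-separated (closed-∁ space v) ,
      down , B⊆ , λ x∉ → dne λ x∉V → x∉ (resize (_ , x∉V , ≤-refl))
      where
      down : Downset X (∁ (↑ᶜ (∁ V)))
      down y≤x x∉ y∈ with unresize y∈
      ... | z , z∉V , z≤y = x∉ (resize (z , z∉V , ≤-trans z≤y y≤x))

      B⊆ : B ⊆ ∁ (↑ᶜ (∁ V))
      B⊆ y∈B y∈ with unresize y∈
      ... | z , z∉V , z≤y = z∉V (↓B⊆V (resize (_ , y∈B , z≤y)))

    -- By transitivity `↑ᶜ A` and `↓ᶜ B` are still unrelated, and closing up first is what lets the
    -- neighbourhoods shrink to an upset and a downset. Reflexivity turns unrelated into disjoint.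
    order-separate : ∀ {A B} → Closed A → Closed B → (∀ {x y} → x ∈ A → y ∈ B → ¬ x ≤ y) →
      ∃[ U ] ∃[ V ] Open U × Upset X U × Open V × Downset X V ×
        A ⊆ U × B ⊆ V × U Disjoint V
    order-separate {A} {B} A-closed B-closed A≰B = shrink neighbourhoods
      where
      ↑A≰↓B : Unrelated space compact _≤_ (↑ᶜ A) (↓ᶜ B)
      ↑A≰↓B x∈↑A y∈↓B x≤y with unresize x∈↑A | unresize y∈↓B
      ... | a , a∈A , a≤x | b , b∈B , y≤b = A≰B a∈A b∈B (≤-trans a≤x (≤-trans x≤y y≤b))

      neighbourhoods : ∃[ V ] (Open V × ∃[ U ] Open U × ↑ᶜ A ⊆ U ×
                         Unrelated space compact _≤_ U V) × ↓ᶜ B ⊆ V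
      neighbourhoods = separate space compact _≤_ ≤-separated {↑ᶜ A} {↓ᶜ B}
        (closed-image space compact _≤_ ≤-separated {A} A-closed)
        (closed-image space compact _≥_ ≥-separated {B} B-closed) ↑A≰↓B

      shrink : (∃[ V ] (Open V × ∃[ U ] Open U × ↑ᶜ A ⊆ U ×
                  Unrelated space compact _≤_ U V) × ↓ᶜ B ⊆ V) →
               ∃[ U ] ∃[ V ] Open U × Upset X U × Open V × Downset X V ×
                 A ⊆ U × B ⊆ V × U Disjoint V
      shrink (V , (v , U , u , ↑A⊆U , U≰V) , ↓B⊆V)
        with upset-interior {A} u ↑A⊆U | downset-interior {B} v ↓B⊆V
      ... | U′ , u′ , up , A⊆U′ , U′⊆U | V′ , v′ , down , B⊆V′ , V′⊆V =
        U′ , V′ , u′ , up , v′ , down , A⊆U′ , B⊆V′ ,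
        λ (x∈U′ , x∈V′) → U≰V (U′⊆U x∈U′) (V′⊆V x∈V′) ≤-refl

    -- The convex Vietoris hyperspace.

    private
      module 𝕍 = TopologicalSpace (𝕍ᶜ X)

    ≤EM-isPartialOrder : IsPartialOrder 𝕍._≈_ (_≤EM_ X)
    ≤EM-isPartialOrder = record
      { isPreorder = record
        { isEquivalence = 𝕍.isEquivalence
        ; reflexive     = λ (K⊆L , L⊆K) →
            (λ (y , y∈L , y≤x) → y , L⊆K y∈L , y≤x) ,
            (λ (y , y∈K , x≤y) → y , K⊆L y∈K , x≤y)
        ; trans         = λ (↑L⊆↑K , ↓K⊆↓L) (↑M⊆↑L , ↓L⊆↓M) →
            (λ x∈ → ↑L⊆↑K (↑M⊆↑L x∈)) , (λ x∈ → ↓L⊆↓M (↓K⊆↓L x∈))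
        }
      ; antisym = λ {K} {L} (↑L⊆↑K , ↓K⊆↓L) (↑K⊆↑L , ↓L⊆↓K) →
          within K L ↑K⊆↑L ↓K⊆↓L , within L K ↑L⊆↑K ↓L⊆↓K
      }
      where
      -- Antisymmetry rests on convexity: each point of `K` is caught between two points of `L`.
      within : ∀ (K L : ClosedConvex X) →
               ↑ X (set K) ⊆ ↑ X (set L) → ↓ X (set K) ⊆ ↓ X (set L) → set K ⊆ set L
      within K L ↑K⊆↑L ↓K⊆↓L x∈K
        with ↑K⊆↑L (_ , x∈K , ≤-refl) | ↓K⊆↓L (_ , x∈K , ≤-refl)
      ... | y , y∈L , y≤x | z , z∈L , x≤z = convex L y∈L z∈L y≤x x≤z

    -- The order amounts to `L` lying in the up-closure of `K` and `K` in the down-closure of `L`,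
    -- so a failure is witnessed by one point, which supplies the `◇` side.
    ≤EM-separated : ∀ {K L} → ¬ (_≤EM_ X K L) →
      ∃[ 𝒰 ] ∃[ 𝒱 ] 𝕍.Open 𝒰 × 𝕍.Open 𝒱 × K ∈ 𝒰 × L ∈ 𝒱 ×
        (∀ {K′ L′} → K′ ∈ 𝒰 → L′ ∈ 𝒱 → ¬ (_≤EM_ X K′ L′))
    ≤EM-separated {K} {L} K≰L with em {P = ∃[ y ] y ∈ set L × y ∉ ↑ X (set K)}
    ... | yes (y , y∈L , y∉↑K) =
      let U , V , u , U-up , v , V-down , K⊆U , ↓y⊆V , U⊥V =
            order-separate (closed K) (closed-lower y)
              (λ x∈K z≤y x≤z → y∉↑K (_ , x∈K , ≤-trans x≤z z≤y))
      in □ X U , ◇ X V , basic (□-open u (inj₁ U-up)) , basic (◇-open v (inj₂ V-down))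
       , K⊆U , (y , y∈L , ↓y⊆V ≤-refl)
       , λ K′⊆U (z , z∈L′ , z∈V) (↑L′⊆↑K′ , _) →
           let x , x∈K′ , x≤z = ↑L′⊆↑K′ (z , z∈L′ , ≤-refl)
           in U⊥V (U-up x≤z (K′⊆U x∈K′) , z∈V)
    ... | no L⊆↑K with em {P = ∃[ x ] x ∈ set K × x ∉ ↓ X (set L)}
    ...   | yes (x , x∈K , x∉↓L) =
      let U , V , u , U-up , v , V-down , ↑x⊆U , L⊆V , U⊥V =
            order-separate (closed-upper x) (closed L)
              (λ x≤z y∈L z≤y → x∉↓L (_ , y∈L , ≤-trans x≤z z≤y))
      in ◇ X U , □ X V , basic (◇-open u (inj₁ U-up)) , basic (□-open v (inj₂ V-down))
       , (x , x∈K , ↑x⊆U ≤-refl) , L⊆V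
       , λ (z , z∈K′ , z∈U) L′⊆V (_ , ↓K′⊆↓L′) →
           let y , y∈L′ , z≤y = ↓K′⊆↓L′ (z , z∈K′ , ≤-refl)
           in U⊥V (z∈U , V-down z≤y (L′⊆V y∈L′))
    ...   | no K⊆↓L = ⊥-elim (K≰L
      ( (λ (y , y∈L , y≤z) →
          let x , x∈K , x≤y = dne λ y∉↑K → L⊆↑K (y , y∈L , y∉↑K)
          in x , x∈K , ≤-trans x≤y y≤z)
      , (λ (x , x∈K , z≤x) →
          let y , y∈L , x≤y = dne λ x∉↓L → K⊆↓L (x , x∈K , x∉↓L)
          in y , y∈L , ≤-trans z≤x x≤y) ))

    𝕍ᶜ-subbasis-compact : {𝒰 : Pred (Pred (ClosedConvex X) (c ⊔ ℓ)) q} →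
      𝒰 ⊆ 𝕍ᶜ-Subbasis X → Covers 𝒰 → FiniteSubcover 𝒰
    𝕍ᶜ-subbasis-compact {𝒰 = 𝒰} 𝒰-subbasic 𝒰-covers = from-member (𝒰-covers K)
      where
      Hit : Pred (Pred Carrier ℓ) _
      Hit V = Open V × (Upset X V ⊎ Downset X V) × ◇ X V ∈ 𝒰

      ⋃Hit : Pred Carrier ℓ
      ⋃Hit x = Resized (∃[ V ] V ∈ Hit × x ∈ V)

      ⋃Hit-open : Open ⋃Hit
      ⋃Hit-open = locally-open space {⋃Hit} neighbourhood
        where
        neighbourhood : ∀ {x} → x ∈ ⋃Hit → ∃[ U ] Open U × x ∈ U × U ⊆ ⋃Hit
        neighbourhood x∈ with unresize x∈
        ... | V , V∈Hit , x∈V = V , proj₁ V∈Hit , x∈V , λ y∈V → resize (V , V∈Hit , y∈V)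

      K : ClosedConvex X
      K .set    = ∁ ⋃Hit
      K .closed = closed-∁ space ⋃Hit-open
      -- An upset containing `x` would contain `y₂`, and a downset would contain `y₁`.
      K .convex y₁∉ y₂∉ y₁≤x x≤y₂ x∈ with unresize x∈
      ... | V , V∈Hit@(_ , inj₁ V-up , _)   , x∈V = y₂∉ (resize (V , V∈Hit , V-up x≤y₂ x∈V))
      ... | V , V∈Hit@(_ , inj₂ V-down , _) , x∈V = y₁∉ (resize (V , V∈Hit , V-down y₁≤x x∈V))

      from-member : (∃[ 𝒲 ] 𝒲 ∈ 𝒰 × K ∈ 𝒲) → FiniteSubcover 𝒰
      from-member (_ , 𝒲∈𝒰 , K∈𝒲) with 𝒰-subbasic 𝒲∈𝒰
      ... | ◇-open {V} v mono with K∈𝒲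
      ...   | x , x∉ , x∈V = contradiction (resize (V , (v , mono , 𝒲∈𝒰) , x∈V)) x∉
      from-member (_ , 𝒲∈𝒰 , K∈𝒲) | □-open {V} v _ =
        -- `K` inside `V` says exactly that the sets in `Hit` cover `∁ V`.
        let Vs , vs , cov = compact-closed space compact (closed-∁ space v) Hit proj₁
              λ x∉V → unresize (dne λ x∉ → x∉V (K∈𝒲 x∉))
        in □ X V ∷ map (◇ X) Vs
         , 𝒲∈𝒰 ∷ All.map⁺ (All.map (λ V∈Hit → proj₂ (proj₂ V∈Hit)) vs)
         , λ L → covered Vs cov L
        where
        covered : ∀ Vs → (∀ {x} → x ∈ ∁ V → Any (x ∈_) Vs) →
                  ∀ L → Any (L ∈_) (□ X V ∷ map (◇ X) Vs)
        -- A set that meets none of the `Vs` misses `∁ V`, hence lies in `V`.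
        covered Vs cov L with em {P = ∃[ x ] x ∈ set L × Any (x ∈_) Vs}
        ... | yes (x , x∈L , x∈Vs) = there (Any.map⁺ (Any.map (λ x∈V → x , x∈L , x∈V) x∈Vs))
        ... | no ∄x = here λ x∈L → dne λ x∉V → ∄x (_ , x∈L , cov x∉V)

    𝕍ᶜ-isCompactOrderedSpace : AxiomOfChoice → IsCompactOrderedSpace (𝕍ᶜ X) (_≤EM_ X)
    𝕍ᶜ-isCompactOrderedSpace choice = record
      { compact        = alexander choice (𝕍ᶜ-setoid X) (𝕍ᶜ-Subbasis X)
                           (λ S → 𝕍.Open-resp (basic S)) 𝕍ᶜ-subbasis-compact
      ; hausdorff      = 𝕍ᶜ-hausdorff
      ; isPartialOrder = ≤EM-isPartialOrder
      ; ≤-closed       = locally-open (productSpace (𝕍ᶜ X) (𝕍ᶜ X)) λ K≰L →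
          let 𝒰 , 𝒱 , u , v , K∈𝒰 , L∈𝒱 , ≰ = ≤EM-separated K≰L
          in _ , basic (box u v) , (K∈𝒰 , L∈𝒱) , λ (K′∈𝒰 , L′∈𝒱) → ≰ K′∈𝒰 L′∈𝒱
      }
      where
      module EM = IsPartialOrder ≤EM-isPartialOrder

      𝕍ᶜ-hausdorff : 𝕍.Hausdorff
      -- By antisymmetry the order fails in one direction, and by reflexivity the two neighbourhoods
      -- separating that failure share no point.
      𝕍ᶜ-hausdorff {K} {L} K≉L with em {P = _≤EM_ X K L}
      ... | no K≰L =
        let 𝒰 , 𝒱 , u , v , K∈𝒰 , L∈𝒱 , ≰ = ≤EM-separated K≰L
        in 𝒰 , 𝒱 , u , v , K∈𝒰 , L∈𝒱 , λ {M} (M∈𝒰 , M∈𝒱) → ≰ M∈𝒰 M∈𝒱 (EM.refl {M})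
      ... | yes K≤L =
        let 𝒱 , 𝒰 , v , u , L∈𝒱 , K∈𝒰 , ≰ =
              ≤EM-separated {L} {K} λ L≤K → K≉L (EM.antisym {K} {L} K≤L L≤K)
        in 𝒰 , 𝒱 , u , v , K∈𝒰 , L∈𝒱 , λ {M} (M∈𝒰 , M∈𝒱) → ≰ M∈𝒱 M∈𝒰 (EM.refl {M})

theorem3p6 : (∀ {ℓ} → ExcludedMiddle ℓ) → AxiomOfChoice →
    ∀ {c ℓ o} (X : CompactOrderedSpace c ℓ o) →
    IsCompactOrderedSpace (𝕍ᶜ X) (_≤EM_ X)
theorem3p6 em choice X = 𝕍ᶜ-isCompactOrderedSpace em X choice
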